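{- There is a cap set in $\mathbb{F}_3^{56232}$ of size \[N:=\binom{11}{7}^{141} \cdot 6^{572} \cdot 12^{572} \cdot 112^{8800} \cdot 37 \cdot 142.\] Consequently, writing $c = N^{1/56232}$ (so $c = 2.218021\ldots$), for every $\varepsilon>0$ there is an integer $M$ such that for all $n \ge M$ there is a cap set $A\subseteq \mathbb{F}_3^n$ with $|A| > (c-\varepsilon)^n$; that is, for large $n$ there are cap sets in $\mathbb{F}_3^n$ of size $(2.218021\ldots)^n$.
   Context: A cap set is a set $A \subseteq \mathbb{F}_3^n$ such that the only solutions of $x+y+z=0$ with $x,y,z\in A$ are those with $x=y=z$ (equivalently, $A$ contains no three distinct elements in arithmetic progression).
   Formalization: The claim is proved for every real ε with 0 < ε ≤ c, so that c − ε is nonnegative; for large ε (for example ε = c + 4 and n even) the literal inequality |A| > (c − ε)^n fails because |A| ≤ 3^n. -}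

module Defs where

open import Data.Fin using (Fin; zero; toℕ)
open import Data.Integer using (+_)
open import Data.List using (List; length)
open import Data.List.Membership.Propositional using (_∈_)
open import Data.List.Relation.Unary.Unique.Propositional using (Unique)
open import Data.Nat as ℕ using (ℕ; zero; suc)
open import Data.Nat.Combinatorics using (_C_)
open import Data.Nat.DivMod using (_mod_)
import Data.Nat.Properties as ℕ
open import Data.Product using (∃-syntax; _×_; _,_)
open import Data.Rational as ℚ using (ℚ; 0ℚ; 1ℚ; ½; ∣_∣)
import Data.Rational.Properties as ℚ
open import Data.Rational.Solver using (module +-*-Solver)
open import Data.Vec using (Vec; zipWith; replicate)
open import Relation.Binary.PropositionalEquality using (_≡_; refl; sym; trans; cong; cong₂; subst)
open import Relation.Nullary using (¬_)

F₃ : Set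
F₃ = Fin 3

_+₃_ : F₃ → F₃ → F₃
a +₃ b = (toℕ a ℕ.+ toℕ b) mod 3

F₃^ : ℕ → Set
F₃^ n = Vec F₃ n

infixl 6 _⊕_
_⊕_ : ∀ {n} → F₃^ n → F₃^ n → F₃^ n
_⊕_ = zipWith _+₃_

𝟎 : ∀ {n} → F₃^ n
𝟎 {n} = replicate n zero

-- A finite subset of F₃ⁿ is given by a repetition-free list of its elements,
-- so that its cardinality is the length of the list.
record CapSet (n : ℕ) : Set where
  field
    elements : List (F₃^ n)
    distinct : Unique elements
    cap      : ∀ {x y z} → x ∈ elements → y ∈ elements → z ∈ elements →
               x ⊕ y ⊕ z ≡ 𝟎 → x ≡ y × y ≡ z

size : ∀ {n} → CapSet n → ℕ
size A = length (CapSet.elements A)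

N : ℕ
N = (11 C 7) ℕ.^ 141 ℕ.* 6 ℕ.^ 572 ℕ.* 12 ℕ.^ 572 ℕ.* 112 ℕ.^ 8800 ℕ.* 37 ℕ.* 142

-- The reals are Cauchy sequences of rationals, with equality _≃_ meaning that
-- the difference tends to 0.

IsCauchy : (ℕ → ℚ) → Set
IsCauchy s = ∀ e → 0ℚ ℚ.< e →
  ∃[ K ] (∀ m n → K ℕ.≤ m → K ℕ.≤ n → ∣ s m ℚ.- s n ∣ ℚ.< e)

record ℝ : Set where
  constructor mkℝ
  field
    seq    : ℕ → ℚ
    cauchy : IsCauchy seq

open ℝ public

infix 4 _≃_ _<_ _≤_

_≃_ : ℝ → ℝ → Set
x ≃ y = ∀ e → 0ℚ ℚ.< e → ∃[ K ] (∀ n → K ℕ.≤ n → ∣ seq x n ℚ.- seq y n ∣ ℚ.< e)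

-- The uniform gap d is needed: a termwise strict inequality would only give
-- x ≤ y in the limit.
_<_ : ℝ → ℝ → Set
x < y = ∃[ d ] (0ℚ ℚ.< d × ∃[ K ] (∀ n → K ℕ.≤ n → seq x n ℚ.+ d ℚ.< seq y n))

_≤_ : ℝ → ℝ → Set
x ≤ y = ¬ (y < x)

fromℚ : ℚ → ℝ
fromℚ q = mkℝ (λ _ → q) λ e 0<e →
  0 , λ _ _ _ _ → subst (ℚ._< e) (sym (cong ∣_∣ (ℚ.+-inverseʳ q))) 0<e

fromℕ : ℕ → ℝ
fromℕ n = fromℚ (+ n ℚ./ 1)

private
  open ℚ.≤-Reasoning

  0<½* : ∀ {e} → 0ℚ ℚ.< e → 0ℚ ℚ.< ½ ℚ.* e
  0<½* {e} 0<e = subst (ℚ._< ½ ℚ.* e) (ℚ.*-zeroʳ ½) (ℚ.*-monoʳ-<-pos ½ 0<e)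

  ½+½ : ∀ e → ½ ℚ.* e ℚ.+ ½ ℚ.* e ≡ e
  ½+½ e = trans (sym (ℚ.*-distribʳ-+ e ½ ½)) (ℚ.*-identityˡ e)

  minus-cauchy : ∀ s t → IsCauchy s → IsCauchy t → IsCauchy (λ n → s n ℚ.- t n)
  minus-cauchy s t cs ct e 0<e
    with cs (½ ℚ.* e) (0<½* 0<e) | ct (½ ℚ.* e) (0<½* 0<e)
  ... | K , f | L , g = K ℕ.⊔ L , λ m n Km Kn → begin-strict
    ∣ (s m ℚ.- t m) ℚ.- (s n ℚ.- t n) ∣
      ≡⟨ cong ∣_∣ (solve 4 (λ a b c d → (a :- b) :- (c :- d) := (a :- c) :- (b :- d))
           refl (s m) (t m) (s n) (t n)) ⟩
    ∣ (s m ℚ.- s n) ℚ.- (t m ℚ.- t n) ∣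
      ≤⟨ ℚ.∣p-q∣≤∣p∣+∣q∣ (s m ℚ.- s n) (t m ℚ.- t n) ⟩
    ∣ s m ℚ.- s n ∣ ℚ.+ ∣ t m ℚ.- t n ∣
      <⟨ ℚ.+-mono-< (f m n (ℕ.m⊔n≤o⇒m≤o K L Km) (ℕ.m⊔n≤o⇒m≤o K L Kn))
                    (g m n (ℕ.m⊔n≤o⇒n≤o K L Km) (ℕ.m⊔n≤o⇒n≤o K L Kn)) ⟩
    ½ ℚ.* e ℚ.+ ½ ℚ.* e
      ≡⟨ ½+½ e ⟩
    e ∎
    where open +-*-Solver

  bounded : ∀ {s} → IsCauchy s →
    ∃[ B ] (0ℚ ℚ.< B × ∃[ K ] (∀ n → K ℕ.≤ n → ∣ s n ∣ ℚ.≤ B))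
  bounded {s} cs with cs 1ℚ (ℚ.positive⁻¹ 1ℚ)
  ... | K , f = 1ℚ ℚ.+ ∣ s K ∣ , ℚ.+-mono-<-≤ (ℚ.positive⁻¹ 1ℚ) (ℚ.0≤∣p∣ (s K)) , K ,
    λ n Kn → begin
      ∣ s n ∣
        ≡⟨ cong ∣_∣ (solve 2 (λ a b → a := (a :- b) :+ b) refl (s n) (s K)) ⟩
      ∣ (s n ℚ.- s K) ℚ.+ s K ∣
        ≤⟨ ℚ.∣p+q∣≤∣p∣+∣q∣ (s n ℚ.- s K) (s K) ⟩
      ∣ s n ℚ.- s K ∣ ℚ.+ ∣ s K ∣
        ≤⟨ ℚ.+-monoˡ-≤ ∣ s K ∣ (ℚ.<⇒≤ (f n K Kn ℕ.≤-refl)) ⟩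
      1ℚ ℚ.+ ∣ s K ∣ ∎
    where open +-*-Solver

  -- For B > 0 and e > 0, the tolerance d = e/B.
  quotient : ∀ {B e} → 0ℚ ℚ.< B → 0ℚ ℚ.< e → ∃[ d ] (0ℚ ℚ.< d × B ℚ.* d ≡ e)
  quotient {B} {e} 0<B 0<e = d , 0<d , Bd≡e
    where
    instance
      B-pos : ℚ.Positive B
      B-pos = ℚ.positive 0<B
      B-nz : ℚ.NonZero B
      B-nz = ℚ.pos⇒nonZero B
      B⁻¹-pos : ℚ.Positive (ℚ.1/ B)
      B⁻¹-pos = ℚ.1/pos⇒pos B
    d : ℚ
    d = ℚ.1/ B ℚ.* e
    0<d : 0ℚ ℚ.< d
    0<d = subst (ℚ._< d) (ℚ.*-zeroʳ (ℚ.1/ B)) (ℚ.*-monoʳ-<-pos (ℚ.1/ B) 0<e)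
    Bd≡e : B ℚ.* d ≡ e
    Bd≡e = trans (sym (ℚ.*-assoc B (ℚ.1/ B) e))
                 (trans (cong (ℚ._* e) (ℚ.*-inverseʳ B)) (ℚ.*-identityˡ e))

  *-bound : ∀ p q B d → 0ℚ ℚ.< B → ∣ p ∣ ℚ.≤ B → ∣ q ∣ ℚ.< d →
    ∣ p ℚ.* q ∣ ℚ.< B ℚ.* d
  *-bound p q B d 0<B p≤B q<d = begin-strict
    ∣ p ℚ.* q ∣         ≡⟨ ℚ.∣p*q∣≡∣p∣*∣q∣ p q ⟩
    ∣ p ∣ ℚ.* ∣ q ∣     ≤⟨ ℚ.*-monoʳ-≤-nonNeg ∣ q ∣ {{ℚ.∣-∣-nonNeg q}} p≤B ⟩
    B ℚ.* ∣ q ∣         <⟨ ℚ.*-monoʳ-<-pos B {{ℚ.positive 0<B}} q<d ⟩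
    B ℚ.* d ∎

  split : ∀ a b a′ b′ →
    a ℚ.* b ℚ.- a′ ℚ.* b′ ≡ a ℚ.* (b ℚ.- b′) ℚ.+ b′ ℚ.* (a ℚ.- a′)
  split = solve 4 (λ a b a′ b′ →
    a :* b :- a′ :* b′ := a :* (b :- b′) :+ b′ :* (a :- a′)) refl
    where open +-*-Solver

  product-close : ∀ a b a′ b′ B D d → 0ℚ ℚ.< B → 0ℚ ℚ.< D →
    ∣ a ∣ ℚ.≤ B → ∣ b′ ∣ ℚ.≤ D → ∣ a ℚ.- a′ ∣ ℚ.< d → ∣ b ℚ.- b′ ∣ ℚ.< d →
    ∣ a ℚ.* b ℚ.- a′ ℚ.* b′ ∣ ℚ.< (B ℚ.+ D) ℚ.* d
  product-close a b a′ b′ B D d 0<B 0<D a≤B b′≤D a-a′ b-b′ = begin-strict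
    ∣ a ℚ.* b ℚ.- a′ ℚ.* b′ ∣
      ≡⟨ cong ∣_∣ (split a b a′ b′) ⟩
    ∣ a ℚ.* (b ℚ.- b′) ℚ.+ b′ ℚ.* (a ℚ.- a′) ∣
      ≤⟨ ℚ.∣p+q∣≤∣p∣+∣q∣ (a ℚ.* (b ℚ.- b′)) (b′ ℚ.* (a ℚ.- a′)) ⟩
    ∣ a ℚ.* (b ℚ.- b′) ∣ ℚ.+ ∣ b′ ℚ.* (a ℚ.- a′) ∣
      <⟨ ℚ.+-mono-< {∣ a ℚ.* (b ℚ.- b′) ∣} {B ℚ.* d} {∣ b′ ℚ.* (a ℚ.- a′) ∣} {D ℚ.* d}
           (*-bound a (b ℚ.- b′) B d 0<B a≤B b-b′)
           (*-bound b′ (a ℚ.- a′) D d 0<D b′≤D a-a′) ⟩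
    B ℚ.* d ℚ.+ D ℚ.* d
      ≡⟨ sym (ℚ.*-distribʳ-+ d B D) ⟩
    (B ℚ.+ D) ℚ.* d ∎

  times-cauchy : ∀ s t → IsCauchy s → IsCauchy t → IsCauchy (λ n → s n ℚ.* t n)
  times-cauchy s t cs ct e 0<e =
    let B , 0<B , K₁ , f₁ = bounded cs
        D , 0<D , K₂ , f₂ = bounded ct
        d , 0<d , eq      = quotient {B ℚ.+ D} {e} (ℚ.+-mono-< {0ℚ} {B} {0ℚ} {D} 0<B 0<D) 0<e
        K₃ , f₃           = cs d 0<d
        K₄ , f₄           = ct d 0<d
    in (K₁ ℕ.⊔ K₂) ℕ.⊔ (K₃ ℕ.⊔ K₄) , λ m n Km Kn →
    let m₁₂ = ℕ.m⊔n≤o⇒m≤o (K₁ ℕ.⊔ K₂) (K₃ ℕ.⊔ K₄) Km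
        m₃₄ = ℕ.m⊔n≤o⇒n≤o (K₁ ℕ.⊔ K₂) (K₃ ℕ.⊔ K₄) Km
        n₁₂ = ℕ.m⊔n≤o⇒m≤o (K₁ ℕ.⊔ K₂) (K₃ ℕ.⊔ K₄) Kn
        n₃₄ = ℕ.m⊔n≤o⇒n≤o (K₁ ℕ.⊔ K₂) (K₃ ℕ.⊔ K₄) Kn
    in subst (∣ s m ℚ.* t m ℚ.- s n ℚ.* t n ∣ ℚ.<_) eq
         (product-close (s m) (t m) (s n) (t n) B D d 0<B 0<D
           (f₁ m (ℕ.m⊔n≤o⇒m≤o K₁ K₂ m₁₂)) (f₂ n (ℕ.m⊔n≤o⇒n≤o K₁ K₂ n₁₂))
           (f₃ m n (ℕ.m⊔n≤o⇒m≤o K₃ K₄ m₃₄) (ℕ.m⊔n≤o⇒m≤o K₃ K₄ n₃₄))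
           (f₄ m n (ℕ.m⊔n≤o⇒n≤o K₃ K₄ m₃₄) (ℕ.m⊔n≤o⇒n≤o K₃ K₄ n₃₄)))

infixl 6 _-_
infixl 7 _*_
infixr 8 _^_

_-_ : ℝ → ℝ → ℝ
x - y = mkℝ (λ n → seq x n ℚ.- seq y n) (minus-cauchy (seq x) (seq y) (cauchy x) (cauchy y))

_*_ : ℝ → ℝ → ℝ
x * y = mkℝ (λ n → seq x n ℚ.* seq y n) (times-cauchy (seq x) (seq y) (cauchy x) (cauchy y))

_^_ : ℝ → ℕ → ℝ
x ^ zero  = fromℕ 1
x ^ suc n = x * x ^ n

_IsPositiveRoot_Of_ : ℝ → ℕ → ℝ → Set
c IsPositiveRoot k Of a = fromℕ 0 < c × c ^ k ≃ a

{-# OPTIONS --safe #-}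
module Submission where

-- Suppose cap sets X₀, X₁, X₂ ⊆ 𝔽₃ⁿ are such that x + y + z = 0 with x ∈ Xₐ, y ∈ X_b, z ∈ X_c
-- is impossible when {a,b,c} is {0,0,1}, {0,0,2} or {0,1,2}.  A word w over {0,1,2} stands for the product
-- of the X_{wᵢ}, and if any three words of a code that are not all equal show one of these patterns in some
-- coordinate, then the union of the products is again a cap set (Edel's extended product).  Several codes over
-- the same alphabet may in turn serve as the letters of the next code.  Starting from the points of 𝔽₃, four such
-- steps with codes of length 6, 6, 3, 4 lead to a cap set B ⊆ 𝔽₃⁴³² with |B| = 792 · (6 · 12 · 112⁵)⁵ · (112⁶)⁷.
-- The last two steps encode 792 words of length 12 with exactly one word for each support of size 7; their rate
-- is so much better than that of the binomial(11,7) words of length 11 behind N that B¹³⁰ × (112-cap)¹² has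
-- more than N points, and |B|^(1/432) > c makes the powers of B, padded by a point, larger than cⁿ.

open import Defs
open import Data.Bool using (Bool; true; false; _∧_; _∨_; not; if_then_else_; T)
open import Data.Empty using (⊥; ⊥-elim)
open import Data.Fin using (Fin; zero; suc; toℕ; _≟_)
open import Data.Fin.Patterns
open import Data.Integer as ℤ using (+_)
import Data.Integer.Properties as ℤ
open import Data.List as List using (List; []; _∷_; _++_; length; concatMap; cartesianProductWith)
open import Data.List.Membership.Propositional using (_∈_; find)
open import Data.List.Membership.Propositional.Properties using (∈-cartesianProductWith⁻; ∈-concatMap⁻)
import Data.List.Properties as List
import Data.List.Relation.Binary.Sublist.Propositional as Sublist
import Data.List.Relation.Binary.Sublist.Propositional.Properties as Sublist
open import Data.List.Relation.Unary.All as All using (All; []; _∷_)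
import Data.List.Relation.Unary.All.Properties as All
open import Data.List.Relation.Unary.AllPairs as AllPairs using (AllPairs; []; _∷_)
import Data.List.Relation.Unary.AllPairs.Properties as AllPairs
open import Data.List.Relation.Unary.Any using (here; there)
open import Data.List.Relation.Unary.Unique.DecPropositional using (unique?)
open import Data.List.Relation.Unary.Unique.Propositional using (Unique)
import Data.List.Relation.Unary.Unique.Propositional.Properties as Unique
open import Data.Nat as ℕ using (ℕ; zero; suc)
import Data.Nat.Coprimality as Coprime
import Data.Nat.DivMod as ℕ
open import Data.Nat.ListAction using (sum)
import Data.Nat.Properties as ℕ
open import Data.Nat.Solver renaming (module +-*-Solver to ℕ-Solver)
open import Data.Product using (Σ-syntax; ∃-syntax; _×_; _,_; proj₁; proj₂)
open import Data.Rational as ℚ using (ℚ; mkℚ; 0ℚ; 1ℚ; ½; ∣_∣; _/_)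
import Data.Rational.Properties as ℚ
open import Data.Rational.Solver renaming (module +-*-Solver to ℚ-Solver)
open import Data.Sum using (inj₁; inj₂)
open import Data.Unit using (⊤; tt)
open import Data.Vec as Vec using (Vec; []; _∷_)
import Data.Vec.Properties as Vec
open import Function using (_∘_)
open import Relation.Binary.PropositionalEquality using (_≡_; refl; sym; trans; cong; cong₂; subst; subst₂)
open import Relation.Nullary using (Dec; does; yes; no; contradiction)
open import Relation.Nullary.Decidable using (⌊_⌋; from-yes; fromWitness; toWitness)

-- Codes

-- R a b c is true if the sets labelled a, b, c may contain x, y, z with x + y + z = 0.
Table : ℕ → Set
Table k = Fin k → Fin k → Fin k → Bool

Compatible : ∀ {k m} → Table k → (u v w : Vec (Fin k) m) → Set
Compatible R []      []      []      = ⊤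
Compatible R (a ∷ u) (b ∷ v) (c ∷ w) = T (R a b c) × Compatible R u v w

tails : ∀ {k m} → Fin k → List (Vec (Fin k) (suc m)) → List (Vec (Fin k) m)
tails a []            = []
tails a ((b ∷ v) ∷ U) = if does (a ≟ b) then v ∷ tails a U else tails a U

every : ∀ {k} → (Fin k → Bool) → Bool
every {zero}  f = true
every {suc k} f = f zero ∧ every (f ∘ suc)

-- An empty list means that no word continues the prefix, so that branch of the search succeeds at
-- once. Hence the base case of `only-diagonal`, when reached letter by letter, speaks of three
-- words that really occur.
unless-empty : ∀ {A : Set} → List A → (List A → Bool) → Bool
unless-empty []          f = true
unless-empty xs@(_ ∷ _) f = f xs

every-head : ∀ {k m} → List (Vec (Fin k) (suc m)) → (Fin k → List (Vec (Fin k) m) → Bool) → Bool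
every-head U f = every λ a → unless-empty (tails a U) (f a)

-- Searches for compatible triples letter by letter, abandoning a prefix as soon as it is incompatible;
-- d records whether the three prefixes read so far agree.
only-diagonal : ∀ {k m} → Table k → Bool → (U V W : List (Vec (Fin k) m)) → Bool
only-diagonal {m = zero}  R d U V W = d
only-diagonal {m = suc m} R d U V W =
  every-head U λ a U′ → every-head V λ b V′ → every-head W λ c W′ →
    not (R a b c) ∨ only-diagonal R (d ∧ does (a ≟ b) ∧ does (b ≟ c)) U′ V′ W′

-- The flag `false` excludes a triple altogether. It serves prefixes that already differ, and also
-- words from codes whose labels form a forbidden triple.
Diagonal : ∀ {A : Set} → Bool → (x y z : A) → Set
Diagonal true  x y z = x ≡ y × y ≡ z
Diagonal false x y z = ⊥

T-∧ˡ : ∀ {x y} → T (x ∧ y) → T x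
T-∧ˡ {true} _ = tt

T-∧ʳ : ∀ {x y} → T (x ∧ y) → T y
T-∧ʳ {true} t = t

T-implies : ∀ {x y} → T (not x ∨ y) → T x → T y
T-implies {true} t _ = t

every⁻ : ∀ {k} (f : Fin k → Bool) → T (every f) → ∀ a → T (f a)
every⁻ f t zero    = T-∧ˡ t
every⁻ f t (suc a) = every⁻ (f ∘ suc) (T-∧ʳ {f zero} t) a

∈-tails : ∀ {k m} {a : Fin k} {v : Vec (Fin k) m} U → a ∷ v ∈ U → v ∈ tails a U
∈-tails {a = a} (.(a ∷ _) ∷ U) (here refl) with a ≟ a
... | yes _   = here refl
... | no  a≢a = contradiction refl a≢a
∈-tails {a = a} ((b ∷ _) ∷ U) (there v∈U) with a ≟ b
... | yes _ = there (∈-tails U v∈U)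
... | no  _ = ∈-tails U v∈U

every-head⁻ : ∀ {k m} {a : Fin k} {v : Vec (Fin k) m} U f →
  T (every-head U f) → a ∷ v ∈ U → T (f a (tails a U))
every-head⁻ {a = a} U f t v∈U
  with tails a U | ∈-tails U v∈U | every⁻ (λ a → unless-empty (tails a U) (f a)) t a
... | _ ∷ _ | _ | s = s

Diagonal-∷ : ∀ {k m} d (a b c : Fin k) {u v w : Vec (Fin k) m} →
  Diagonal (d ∧ does (a ≟ b) ∧ does (b ≟ c)) u v w → Diagonal d (a ∷ u) (b ∷ v) (c ∷ w)
Diagonal-∷ true a b c D with a ≟ b | b ≟ c
Diagonal-∷ true a .a .a (refl , refl) | yes refl | yes refl = refl , refl

-- Soundness of the search: its tests are instantiated at the actual letters of the three words,
-- whose lists of tails are non-empty because they contain the actual tails. A Boolean found by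
-- evaluation thus becomes a statement about all compatible triples.
only-diagonal⁻ : ∀ {k m} (R : Table k) d (U V W : List (Vec (Fin k) m)) {u v w} →
  T (only-diagonal R d U V W) → u ∈ U → v ∈ V → w ∈ W → Compatible R u v w → Diagonal d u v w
only-diagonal⁻ {m = zero} R true U V W {[]} {[]} {[]} _ _ _ _ _ = refl , refl
only-diagonal⁻ {m = suc m} R d U V W {a ∷ u} {b ∷ v} {c ∷ w} t u∈U v∈V w∈W (r , rs) =
  Diagonal-∷ d a b c
    (only-diagonal⁻ R (d ∧ does (a ≟ b) ∧ does (b ≟ c)) (tails a U) (tails b V) (tails c W)
      (T-implies {R a b c} (every-head⁻ W _ (every-head⁻ V _ (every-head⁻ U _ t u∈U) v∈V) w∈W) r)
      (∈-tails U u∈U) (∈-tails V v∈V) (∈-tails W w∈W) rs)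

-- Products of cap sets

elements : ∀ {n} → CapSet n → List (F₃^ n)
elements = CapSet.elements

single : ∀ {n} → F₃^ n → CapSet n
single x .CapSet.elements = x ∷ []
single x .CapSet.distinct = [] ∷ []
single x .CapSet.cap (here refl) (here refl) (here refl) _ = refl , refl

++-sum-zero : ∀ {m n} (x y z : F₃^ m) {x′ y′ z′ : F₃^ n} →
  (x Vec.++ x′) ⊕ (y Vec.++ y′) ⊕ (z Vec.++ z′) ≡ 𝟎 → x ⊕ y ⊕ z ≡ 𝟎 × x′ ⊕ y′ ⊕ z′ ≡ 𝟎
++-sum-zero []      []      []      eq = refl , eq
++-sum-zero (_ ∷ x) (_ ∷ y) (_ ∷ z) eq =
  let eq₁ , eq₂ = ++-sum-zero x y z (Vec.∷-injectiveʳ eq)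
  in cong₂ _∷_ (Vec.∷-injectiveˡ eq) eq₁ , eq₂

infixr 7 _⊗_
_⊗_ : ∀ {m n} → CapSet m → CapSet n → CapSet (m ℕ.+ n)
(A ⊗ B) .CapSet.elements = cartesianProductWith Vec._++_ (elements A) (elements B)
(A ⊗ B) .CapSet.distinct = Unique.cartesianProductWith⁺ Vec._++_ (Vec.++-injective _ _)
                             (CapSet.distinct A) (CapSet.distinct B)
(A ⊗ B) .CapSet.cap x∈ y∈ z∈ eq
  with ∈-cartesianProductWith⁻ Vec._++_ (elements A) (elements B) x∈
     | ∈-cartesianProductWith⁻ Vec._++_ (elements A) (elements B) y∈
     | ∈-cartesianProductWith⁻ Vec._++_ (elements A) (elements B) z∈
... | x , x′ , x∈A , x′∈B , refl | y , y′ , y∈A , y′∈B , refl | z , z′ , z∈A , z′∈B , refl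
  with ++-sum-zero x y z eq
... | eq₁ , eq₂ with CapSet.cap A x∈A y∈A z∈A eq₁ | CapSet.cap B x′∈B y′∈B z′∈B eq₂
... | refl , refl | refl , refl = refl , refl

length-cartesianProductWith : ∀ {A B C : Set} (f : A → B → C) xs ys →
  length (cartesianProductWith f xs ys) ≡ length xs ℕ.* length ys
length-cartesianProductWith f []       ys = refl
length-cartesianProductWith f (x ∷ xs) ys =
  trans (List.length-++ (List.map (f x) ys))
        (cong₂ ℕ._+_ (List.length-map (f x) ys) (length-cartesianProductWith f xs ys))

size-⊗ : ∀ {m n} (A : CapSet m) (B : CapSet n) → size (A ⊗ B) ≡ size A ℕ.* size B
size-⊗ A B = length-cartesianProductWith Vec._++_ (elements A) (elements B)

power : ∀ {n} → CapSet n → ∀ q → CapSet (q ℕ.* n)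
power A zero    = single []
power A (suc q) = A ⊗ power A q

size-power : ∀ {n} (A : CapSet n) q → size (power A q) ≡ size A ℕ.^ q
size-power A zero    = refl
size-power A (suc q) = trans (size-⊗ A (power A q)) (cong (size A ℕ.*_) (size-power A q))

-- Subsets of cap sets are cap sets, so a cap set that is too large can be cut down to an exact
-- size.
shrink : ∀ {n} s (A : CapSet n) → s ℕ.≤ size A → Σ[ B ∈ CapSet n ] size B ≡ s
shrink s A s≤ = record
  { elements = List.take s (elements A)
  ; distinct = Unique.take⁺ s (CapSet.distinct A)
  ; cap      = λ x∈ y∈ z∈ → CapSet.cap A (take-⊆ x∈) (take-⊆ y∈) (take-⊆ z∈)
  } , trans (List.length-take s (elements A)) (ℕ.m≤n⇒m⊓n≡m s≤)
  where
  take-⊆ : ∀ {x} → x ∈ List.take s (elements A) → x ∈ elements A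
  take-⊆ = Sublist.lookup (Sublist.take-⊆ s (elements A))

-- Systems of cap sets

-- The letters of an extended product. The caps of different labels may overlap; `R` only has to
-- allow every triple of labels that admits a zero sum.
record System {k : ℕ} (R : Table k) (n : ℕ) (s : Fin k → ℕ) : Set where
  field
    caps      : Fin k → CapSet n
    size-caps : ∀ a → size (caps a) ≡ s a
    sum-zero  : ∀ {a b c x y z} →
      x ∈ elements (caps a) → y ∈ elements (caps b) → z ∈ elements (caps c) →
      x ⊕ y ⊕ z ≡ 𝟎 → T (R a b c)

weight : ∀ {k m} → (Fin k → ℕ) → Vec (Fin k) m → ℕ
weight s []      = 1
weight s (a ∷ w) = s a ℕ.* weight s w

AllPairs-map-∈ : ∀ {A : Set} {P Q : A → A → Set} {xs} →
  (∀ {x y} → x ∈ xs → y ∈ xs → P x y → Q x y) → AllPairs P xs → AllPairs Q xs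
AllPairs-map-∈ f []       = []
AllPairs-map-∈ f (p ∷ ps) =
  All.tabulate (λ y∈ → f (here refl) (there y∈) (All.lookup p y∈)) ∷
  AllPairs-map-∈ (λ x∈ y∈ → f (there x∈) (there y∈)) ps

length-concatMap : ∀ {A B : Set} (f : A → List B) (g : A → ℕ) → (∀ x → length (f x) ≡ g x) →
  ∀ xs → length (concatMap f xs) ≡ sum (List.map g xs)
length-concatMap f g eq []       = refl
length-concatMap f g eq (x ∷ xs) =
  trans (List.length-++ (f x)) (cong₂ ℕ._+_ (eq x) (length-concatMap f g eq xs))

⊕-self : ∀ {n} (x : F₃^ n) → x ⊕ x ⊕ x ≡ 𝟎
⊕-self []       = refl
⊕-self (0F ∷ x) = cong (0F ∷_) (⊕-self x)
⊕-self (1F ∷ x) = cong (0F ∷_) (⊕-self x)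
⊕-self (2F ∷ x) = cong (0F ∷_) (⊕-self x)

module _ {k : ℕ} {R : Table k} {n : ℕ} {s : Fin k → ℕ} (S : System R n s) where
  open System S

  word : ∀ {m} → Vec (Fin k) m → CapSet (m ℕ.* n)
  word []      = single []
  word (a ∷ w) = caps a ⊗ word w

  size-word : ∀ {m} (w : Vec (Fin k) m) → size (word w) ≡ weight s w
  size-word []      = refl
  size-word (a ∷ w) = trans (size-⊗ (caps a) (word w)) (cong₂ ℕ._*_ (size-caps a) (size-word w))

  word-compatible : ∀ {m} (u v w : Vec (Fin k) m) {x y z} →
    x ∈ elements (word u) → y ∈ elements (word v) → z ∈ elements (word w) →
    x ⊕ y ⊕ z ≡ 𝟎 → Compatible R u v w
  word-compatible []      []      []      _  _  _  _  = tt
  word-compatible (a ∷ u) (b ∷ v) (c ∷ w) x∈ y∈ z∈ eq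
    with ∈-cartesianProductWith⁻ Vec._++_ (elements (caps a)) (elements (word u)) x∈
       | ∈-cartesianProductWith⁻ Vec._++_ (elements (caps b)) (elements (word v)) y∈
       | ∈-cartesianProductWith⁻ Vec._++_ (elements (caps c)) (elements (word w)) z∈
  ... | x , x′ , x∈a , x′∈u , refl | y , y′ , y∈b , y′∈v , refl | z , z′ , z∈c , z′∈w , refl =
    let eq₁ , eq₂ = ++-sum-zero x y z eq
    in sum-zero x∈a y∈b z∈c eq₁ , word-compatible u v w x′∈u y′∈v z′∈w eq₂

  union : ∀ {m} (W : List (Vec (Fin k) m)) → Unique W → T (only-diagonal R true W W W) → CapSet (m ℕ.* n)
  union W W! ok .CapSet.elements = concatMap (elements ∘ word) W
  union W W! ok .CapSet.distinct =
    Unique.concat⁺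
      (All.map⁺ (All.universal (CapSet.distinct ∘ word) W))
      -- A point x common to the products of u and v gives the zero sum x + x + x with words u, u,
      -- v, so the code forces u = v. Products of different words are therefore disjoint.
      (AllPairs.map⁺ (AllPairs-map-∈
        (λ {u} {v} u∈W v∈W u≢v {x} (x∈u , x∈v) → u≢v (proj₂
          (only-diagonal⁻ R true W W W ok u∈W u∈W v∈W (word-compatible u u v x∈u x∈u x∈v (⊕-self x)))))
        W!))
  union W W! ok .CapSet.cap x∈ y∈ z∈ eq
    with find (∈-concatMap⁻ _ {xs = W} x∈) | find (∈-concatMap⁻ _ {xs = W} y∈) | find (∈-concatMap⁻ _ {xs = W} z∈)
  ... | u , u∈W , x∈u | v , v∈W , y∈v | w , w∈W , z∈w
    -- The zero sum makes the three words compatible, hence equal, and a single product of caps is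
    -- itself a cap.
    with only-diagonal⁻ R true W W W ok u∈W v∈W w∈W (word-compatible u v w x∈u y∈v z∈w eq)
  ... | refl , refl = CapSet.cap (word u) x∈u y∈v z∈w eq

  size-union : ∀ {m} (W : List (Vec (Fin k) m)) W! ok → size (union W W! ok) ≡ sum (List.map (weight s) W)
  size-union W W! ok = length-concatMap (elements ∘ word) (weight s) size-word W

  -- One step of the iteration: the unions over the codes `W i` become the letters of a new system.
  -- The Boolean hypotheses say that words do not repeat, that each code yields a cap, that triples
  -- forbidden by `R′` have no compatible words, and that the sizes are as claimed; for concrete
  -- codes evaluation settles all four.
  compose : ∀ {l m} (R′ : Table l) (s′ : Fin l → ℕ) (W : Fin l → List (Vec (Fin k) m)) →
    T (every λ i → ⌊ unique? (Vec.≡-dec _≟_) (W i) ⌋) →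
    T (every λ i → only-diagonal R true (W i) (W i) (W i)) →
    T (every λ i → every λ j → every λ h → R′ i j h ∨ only-diagonal R false (W i) (W j) (W h)) →
    T (every λ i → sum (List.map (weight s) (W i)) ℕ.≡ᵇ s′ i) →
    System R′ (m ℕ.* n) s′
  compose R′ s′ W W! diag off sizes .System.caps i =
    union (W i) (toWitness (every⁻ _ W! i)) (every⁻ _ diag i)
  compose R′ s′ W W! diag off sizes .System.size-caps i =
    trans (size-union (W i) (toWitness (every⁻ _ W! i)) (every⁻ _ diag i)) (ℕ.≡ᵇ⇒≡ _ _ (every⁻ _ sizes i))
  compose R′ s′ W W! diag off sizes .System.sum-zero {i} {j} {h} x∈ y∈ z∈ eq
    with find (∈-concatMap⁻ _ {xs = W i} x∈) | find (∈-concatMap⁻ _ {xs = W j} y∈) | find (∈-concatMap⁻ _ {xs = W h} z∈)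
  ... | u , u∈W , x∈u | v , v∈W , y∈v | w , w∈W , z∈w
    with R′ i j h | every⁻ _ (every⁻ _ (every⁻ _ off i) j) h
  ... | true  | _  = tt
  ... | false | ok = only-diagonal⁻ R false (W i) (W j) (W h) ok u∈W v∈W w∈W
                       (word-compatible u v w x∈u y∈v z∈w eq)

-- The construction

sumsToZero : Table 3
sumsToZero a b c = ⌊ (a +₃ b) +₃ c ≟ 0F ⌋

points : System sumsToZero 1 (λ _ → 1)
points .System.caps a = single (a ∷ [])
points .System.size-caps a = refl
points .System.sum-zero (here refl) (here refl) (here refl) eq = fromWitness {a? = _ ≟ 0F} (Vec.∷-injectiveˡ eq)

-- False exactly on the multisets {0,0,1}, {0,0,2}, {0,1,2}.
may-clash : Table 3
may-clash 0F b  c  = does (b ≟ c)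
may-clash a  0F c  = does (a ≟ c)
may-clash a  b  0F = does (a ≟ b)
may-clash _  _  _  = true

-- All vectors with the support of the given one, since 2 = -1 in 𝔽₃.
signings : ∀ {m} → Vec F₃ m → List (F₃^ m)
signings []       = [] ∷ []
signings (0F ∷ v) = List.map (0F ∷_) (signings v)
signings (_  ∷ v) = List.map (1F ∷_) (signings v) ++ List.map (2F ∷_) (signings v)

even odd : ∀ m → List (F₃^ m)
even zero    = [] ∷ []
even (suc m) = List.map (1F ∷_) (even m) ++ List.map (2F ∷_) (odd m)
odd zero     = []
odd (suc m)  = List.map (1F ∷_) (odd m) ++ List.map (2F ∷_) (even m)

-- The blocks form a 2-(6,3,2) design, invariant under rotation of the last five coordinates.
unitVectors blocks coblocks : List (F₃^ 6)
unitVectors =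
  (1F ∷ 0F ∷ 0F ∷ 0F ∷ 0F ∷ 0F ∷ []) ∷ (0F ∷ 1F ∷ 0F ∷ 0F ∷ 0F ∷ 0F ∷ []) ∷
  (0F ∷ 0F ∷ 1F ∷ 0F ∷ 0F ∷ 0F ∷ []) ∷ (0F ∷ 0F ∷ 0F ∷ 1F ∷ 0F ∷ 0F ∷ []) ∷
  (0F ∷ 0F ∷ 0F ∷ 0F ∷ 1F ∷ 0F ∷ []) ∷ (0F ∷ 0F ∷ 0F ∷ 0F ∷ 0F ∷ 1F ∷ []) ∷ []
blocks =
  (1F ∷ 1F ∷ 1F ∷ 0F ∷ 0F ∷ 0F ∷ []) ∷ (1F ∷ 0F ∷ 1F ∷ 1F ∷ 0F ∷ 0F ∷ []) ∷
  (1F ∷ 0F ∷ 0F ∷ 1F ∷ 1F ∷ 0F ∷ []) ∷ (1F ∷ 0F ∷ 0F ∷ 0F ∷ 1F ∷ 1F ∷ []) ∷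
  (1F ∷ 1F ∷ 0F ∷ 0F ∷ 0F ∷ 1F ∷ []) ∷ (0F ∷ 1F ∷ 1F ∷ 0F ∷ 1F ∷ 0F ∷ []) ∷
  (0F ∷ 0F ∷ 1F ∷ 1F ∷ 0F ∷ 1F ∷ []) ∷ (0F ∷ 1F ∷ 0F ∷ 1F ∷ 1F ∷ 0F ∷ []) ∷
  (0F ∷ 0F ∷ 1F ∷ 0F ∷ 1F ∷ 1F ∷ []) ∷ (0F ∷ 1F ∷ 0F ∷ 1F ∷ 0F ∷ 1F ∷ []) ∷ []
coblocks = List.map (Vec.map (λ a → if does (a ≟ 0F) then 1F else 0F)) blocks

-- Edel's caps: the 12 points ±eᵢ, and twice 80 signed blocks together with the 32 vectors without
-- zeros that have an even number of 2s.
edel-code : Fin 3 → List (F₃^ 6)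
edel-code 0F = concatMap signings unitVectors
edel-code 1F = concatMap signings blocks ++ even 6
edel-code 2F = concatMap signings coblocks ++ even 6

edelSize : Fin 3 → ℕ
edelSize 0F = 12
edelSize _  = 112

opaque
  edelSystem : System may-clash 6 edelSize
  edelSystem = compose points may-clash edelSize edel-code tt tt tt tt

-- For i < j the words with a 0 at i and at j have 1 and 2 in each other's place, so that
-- together with 2⁶ they show {0,1,2} at j, and together with 1⁶ at i.
tournament : Fin 3 → List (Vec (Fin 3) 6)
tournament 0F =
  (0F ∷ 1F ∷ 1F ∷ 1F ∷ 1F ∷ 1F ∷ []) ∷ (2F ∷ 0F ∷ 1F ∷ 1F ∷ 1F ∷ 1F ∷ []) ∷
  (2F ∷ 2F ∷ 0F ∷ 1F ∷ 1F ∷ 1F ∷ []) ∷ (2F ∷ 2F ∷ 2F ∷ 0F ∷ 1F ∷ 1F ∷ []) ∷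
  (2F ∷ 2F ∷ 2F ∷ 2F ∷ 0F ∷ 1F ∷ []) ∷ (2F ∷ 2F ∷ 2F ∷ 2F ∷ 2F ∷ 0F ∷ []) ∷ []
tournament a = Vec.replicate 6 a ∷ []

tournamentSize : Fin 3 → ℕ
tournamentSize 0F = 6 ℕ.* 12 ℕ.* 112 ℕ.^ 5
tournamentSize _  = 112 ℕ.^ 6

opaque
  tournamentSystem : System may-clash 36 tournamentSize
  tournamentSystem = compose {n = 6} edelSystem may-clash tournamentSize tournament tt tt tt tt

rotations : Vec (Fin 3) 3 → List (Vec (Fin 3) 3)
rotations v@(a ∷ b ∷ c ∷ []) = v ∷ (b ∷ c ∷ a ∷ []) ∷ (c ∷ a ∷ b ∷ []) ∷ []

-- Each letter contains exactly one word for every support of its rank. The two letters of a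
-- positive rank differ by exchanging 1 and 2.
letters : Fin 7 → List (Vec (Fin 3) 3)
letters 0F = Vec.replicate 3 0F ∷ []
letters 1F = rotations (1F ∷ 0F ∷ 0F ∷ [])
letters 2F = rotations (2F ∷ 0F ∷ 0F ∷ [])
letters 3F = rotations (1F ∷ 2F ∷ 0F ∷ [])
letters 4F = rotations (2F ∷ 1F ∷ 0F ∷ [])
letters 5F = Vec.replicate 3 1F ∷ []
letters 6F = Vec.replicate 3 2F ∷ []

letterSize : Fin 7 → ℕ
letterSize a = sum (List.map (weight tournamentSize) (letters a))

-- The size of the support of the words in letters a.
rank : Fin 7 → ℕ
rank a = ℕ.⌈ toℕ a /2⌉

-- Two equal letters clash with each letter of at most their rank, and two different letters of the same
-- rank clash with those of the next rank.
letter-clashes : Table 7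
letter-clashes a b c = clash a b c ∨ clash b c a ∨ clash c a b
  where
  clash : Fin 7 → Fin 7 → Fin 7 → Bool
  clash x y z = if does (x ≟ y) then rank z ℕ.≤ᵇ rank x
                else (rank x ℕ.≡ᵇ rank y) ∧ (rank z ℕ.≡ᵇ suc (rank x))

opaque
  letterSystem : System letter-clashes 108 letterSize
  letterSystem = compose {n = 36} tournamentSystem letter-clashes letterSize letters tt tt tt tt

-- One word for each of the 40 ordered sums 7 = r₁ + r₂ + r₃ + r₄ of ranks.  The choice between the
-- two letters of each positive rank was found by a randomised local search.
admissible : List (Vec (Fin 7) 4)
admissible =
  (0F ∷ 2F ∷ 6F ∷ 5F ∷ []) ∷ (0F ∷ 4F ∷ 4F ∷ 6F ∷ [])
  ∷ (0F ∷ 3F ∷ 5F ∷ 4F ∷ []) ∷ (0F ∷ 6F ∷ 1F ∷ 5F ∷ [])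
  ∷ (0F ∷ 6F ∷ 4F ∷ 4F ∷ []) ∷ (0F ∷ 5F ∷ 6F ∷ 1F ∷ [])
  ∷ (2F ∷ 0F ∷ 5F ∷ 5F ∷ []) ∷ (2F ∷ 1F ∷ 4F ∷ 6F ∷ [])
  ∷ (2F ∷ 1F ∷ 5F ∷ 3F ∷ []) ∷ (1F ∷ 4F ∷ 2F ∷ 5F ∷ [])
  ∷ (1F ∷ 4F ∷ 3F ∷ 3F ∷ []) ∷ (2F ∷ 3F ∷ 5F ∷ 2F ∷ [])
  ∷ (1F ∷ 6F ∷ 0F ∷ 5F ∷ []) ∷ (1F ∷ 5F ∷ 2F ∷ 4F ∷ [])
  ∷ (2F ∷ 5F ∷ 3F ∷ 1F ∷ []) ∷ (1F ∷ 5F ∷ 6F ∷ 0F ∷ [])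
  ∷ (3F ∷ 0F ∷ 3F ∷ 5F ∷ []) ∷ (4F ∷ 0F ∷ 5F ∷ 4F ∷ [])
  ∷ (3F ∷ 1F ∷ 2F ∷ 5F ∷ []) ∷ (3F ∷ 2F ∷ 3F ∷ 3F ∷ [])
  ∷ (4F ∷ 2F ∷ 6F ∷ 2F ∷ []) ∷ (3F ∷ 3F ∷ 0F ∷ 6F ∷ [])
  ∷ (4F ∷ 4F ∷ 2F ∷ 3F ∷ []) ∷ (3F ∷ 3F ∷ 3F ∷ 1F ∷ [])
  ∷ (4F ∷ 4F ∷ 6F ∷ 0F ∷ []) ∷ (3F ∷ 6F ∷ 0F ∷ 4F ∷ [])
  ∷ (4F ∷ 6F ∷ 2F ∷ 2F ∷ []) ∷ (4F ∷ 6F ∷ 4F ∷ 0F ∷ [])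
  ∷ (6F ∷ 0F ∷ 1F ∷ 5F ∷ []) ∷ (5F ∷ 0F ∷ 3F ∷ 3F ∷ [])
  ∷ (5F ∷ 0F ∷ 5F ∷ 1F ∷ []) ∷ (5F ∷ 1F ∷ 0F ∷ 6F ∷ [])
  ∷ (6F ∷ 2F ∷ 1F ∷ 3F ∷ []) ∷ (6F ∷ 2F ∷ 4F ∷ 2F ∷ [])
  ∷ (5F ∷ 2F ∷ 6F ∷ 0F ∷ []) ∷ (6F ∷ 3F ∷ 0F ∷ 4F ∷ [])
  ∷ (6F ∷ 3F ∷ 1F ∷ 1F ∷ []) ∷ (6F ∷ 3F ∷ 4F ∷ 0F ∷ [])
  ∷ (5F ∷ 6F ∷ 0F ∷ 1F ∷ []) ∷ (5F ∷ 6F ∷ 2F ∷ 0F ∷ []) ∷ []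

opaque
  cap432 : Σ[ A ∈ CapSet 432 ] size A ≡ 792 ℕ.* (6 ℕ.* 12 ℕ.* 112 ℕ.^ 5) ℕ.^ 5 ℕ.* (112 ℕ.^ 6) ℕ.^ 7
  -- A support of size 7 in 12 coordinates splits into four blocks of three, whose ranks form one of
  -- the 40 sums; so each of the binomial(12,7) = 792 supports occurs once. Each word has five 0s
  -- and seven other letters, which gives the remaining factors.
  cap432 = union {n = 108} letterSystem {4} admissible W! tt , size-union {n = 108} letterSystem {4} admissible W! tt
    where
    W! : Unique admissible
    W! = from-yes (unique? (Vec.≡-dec _≟_) admissible)

-- Numerical bounds

-- x ^ 56232 as iterated powers, which take far fewer multiplications to evaluate.
tower : ℕ → ℕ
tower x = (((x ℕ.^ 71) ℕ.^ 8) ℕ.^ 9) ℕ.^ 11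

tower≡^ : ∀ x → tower x ≡ x ℕ.^ 56232
tower≡^ x = subst (λ n → tower x ≡ x ℕ.^ n) {71 ℕ.* 8 ℕ.* 9 ℕ.* 11} {56232} refl
  (trans (cong (ℕ._^ 11) (trans (cong (ℕ._^ 9) (ℕ.^-*-assoc x 71 8)) (ℕ.^-*-assoc x (71 ℕ.* 8) 9)))
         (ℕ.^-*-assoc x (71 ℕ.* 8 ℕ.* 9) 11))

tower-≤ : ∀ x y z → T (tower x ℕ.≤ᵇ z ℕ.* tower y) → x ℕ.^ 56232 ℕ.≤ z ℕ.* y ℕ.^ 56232
tower-≤ x y z t = subst₂ (λ u v → u ℕ.≤ z ℕ.* v) (tower≡^ x) (tower≡^ y) (ℕ.≤ᵇ⇒≤ (tower x) (z ℕ.* tower y) t)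

tower-< : ∀ x y z → T (z ℕ.* tower y ℕ.<ᵇ tower x) → z ℕ.* y ℕ.^ 56232 ℕ.< x ℕ.^ 56232
tower-< x y z t = subst₂ (λ u v → z ℕ.* v ℕ.< u) (tower≡^ x) (tower≡^ y) (ℕ.<ᵇ⇒< (z ℕ.* tower y) (tower x) t)

opaque
  lower : 2218021 ℕ.^ 56232 ℕ.≤ N ℕ.* 1000000 ℕ.^ 56232
  lower = tower-≤ 2218021 1000000 N tt

  -- The number 2.2180213 is chosen between c and the 432nd root of the size of `cap432`: it bounds
  -- c from above here and is the growth rate beaten in `eventually-large`.
  upper : N ℕ.* 10000000 ℕ.^ 56232 ℕ.< 22180213 ℕ.^ 56232
  upper = tower-< 22180213 10000000 N tt

^-distribʳ-* : ∀ n x y → (x ℕ.* y) ℕ.^ n ≡ x ℕ.^ n ℕ.* y ℕ.^ n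
^-distribʳ-* zero    x y = refl
^-distribʳ-* (suc n) x y = trans (cong (x ℕ.* y ℕ.*_) (^-distribʳ-* n x y)) (ℕ.[m*n]*[o*p]≡[m*o]*[n*p] x y _ _)

-- (1 + 1/x)^q ≥ 1 + q/x, multiplied by x^(q+1).
bernoulli : ∀ x q → (x ℕ.+ q) ℕ.* x ℕ.^ q ℕ.≤ x ℕ.* suc x ℕ.^ q
bernoulli x zero    = ℕ.≤-reflexive (cong (ℕ._* 1) (ℕ.+-identityʳ x))
bernoulli x (suc q) = begin
  (x ℕ.+ suc q) ℕ.* (x ℕ.* x ℕ.^ q)                     ≤⟨ ℕ.m≤m+n _ (q ℕ.* x ℕ.^ q) ⟩
  (x ℕ.+ suc q) ℕ.* (x ℕ.* x ℕ.^ q) ℕ.+ q ℕ.* x ℕ.^ q   ≡⟨ solve 3 (λ x q p →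
      (x :+ (con 1 :+ q)) :* (x :* p) :+ q :* p := (con 1 :+ x) :* ((x :+ q) :* p)) refl x q (x ℕ.^ q) ⟩
  suc x ℕ.* ((x ℕ.+ q) ℕ.* x ℕ.^ q)                     ≤⟨ ℕ.*-monoʳ-≤ (suc x) (bernoulli x q) ⟩
  suc x ℕ.* (x ℕ.* suc x ℕ.^ q)                         ≡⟨ solve 2 (λ x p →
      (con 1 :+ x) :* (x :* p) := x :* ((con 1 :+ x) :* p)) refl x (suc x ℕ.^ q) ⟩
  x ℕ.* (suc x ℕ.* suc x ℕ.^ q)                         ∎
  where
  open ℕ.≤-Reasoning
  open ℕ-Solver

-- By Bernoulli, (x + 1)^q is at least (1 + q/x) x^q, and q/x is at least C. A strictly larger base
-- thus absorbs any constant factor.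
*-^-<-^ : ∀ {x y q} C .{{_ : ℕ.NonZero x}} → x ℕ.< y → C ℕ.* x ℕ.≤ q → C ℕ.* x ℕ.^ q ℕ.< y ℕ.^ q
*-^-<-^ {x} {y} {q} C x<y Cx≤q = ℕ.<-≤-trans (ℕ.*-cancelˡ-< x _ _ (begin-strict
  x ℕ.* (C ℕ.* x ℕ.^ q)   ≡⟨ solve 3 (λ x C p → x :* (C :* p) := C :* x :* p) refl x C (x ℕ.^ q) ⟩
  C ℕ.* x ℕ.* x ℕ.^ q     ≤⟨ ℕ.*-monoˡ-≤ (x ℕ.^ q) Cx≤q ⟩
  q ℕ.* x ℕ.^ q           <⟨ ℕ.*-monoˡ-< (x ℕ.^ q) {{ℕ.m^n≢0 x q}} (ℕ.m<n+m q (ℕ.>-nonZero⁻¹ x)) ⟩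
  (x ℕ.+ q) ℕ.* x ℕ.^ q   ≤⟨ bernoulli x q ⟩
  x ℕ.* suc x ℕ.^ q       ∎)) (ℕ.^-monoˡ-≤ q x<y)
  where
  open ℕ.≤-Reasoning
  open ℕ-Solver

-- Write n = r + qm with r < m and pad the q-th power of B by one point in r coordinates. The
-- padding costs at most a factor p^m, which the q-th power of the strict inequality outgrows.
powers-exceed : ∀ {m} .{{_ : ℕ.NonZero m}} (B : CapSet m) p d .{{_ : ℕ.NonZero p}} .{{_ : ℕ.NonZero d}} →
  p ℕ.^ m ℕ.< size B ℕ.* d ℕ.^ m →
  ∃[ M ] (∀ n → M ℕ.≤ n → Σ[ A ∈ CapSet n ] p ℕ.^ n ℕ.< size A ℕ.* d ℕ.^ n)
-- This makes the quotient q at least p^m · p^m: one factor is the loss to absorb, the other the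
-- base in `*-^-<-^`.
powers-exceed {m} B p d lt = p ℕ.^ m ℕ.* p ℕ.^ m ℕ.* m , λ n M≤n →
  subst (λ n → Σ[ A ∈ CapSet n ] p ℕ.^ n ℕ.< size A ℕ.* d ℕ.^ n) (sym (ℕ.m≡m%n+[m/n]*n n m))
    (padded (n ℕ.% m) (n ℕ./ m) (ℕ.<⇒≤ (ℕ.m%n<n n m))
      (subst (ℕ._≤ n ℕ./ m) (ℕ.m*n/n≡m _ m) (ℕ./-monoˡ-≤ m M≤n)))
  where
  open ℕ.≤-Reasoning
  open ℕ-Solver
  padded : ∀ r q → r ℕ.≤ m → p ℕ.^ m ℕ.* p ℕ.^ m ℕ.≤ q →
    Σ[ A ∈ CapSet (r ℕ.+ q ℕ.* m) ] p ℕ.^ (r ℕ.+ q ℕ.* m) ℕ.< size A ℕ.* d ℕ.^ (r ℕ.+ q ℕ.* m)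
  padded r q r≤m large = single 𝟎 ⊗ power B q , (begin-strict
    p ℕ.^ (r ℕ.+ q ℕ.* m)                         ≡⟨ ℕ.^-distribˡ-+-* p r (q ℕ.* m) ⟩
    p ℕ.^ r ℕ.* p ℕ.^ (q ℕ.* m)                   ≡⟨ cong (p ℕ.^ r ℕ.*_) (^-swap p) ⟩
    p ℕ.^ r ℕ.* (p ℕ.^ m) ℕ.^ q                   ≤⟨ ℕ.*-monoˡ-≤ ((p ℕ.^ m) ℕ.^ q) (ℕ.^-monoʳ-≤ p r≤m) ⟩
    p ℕ.^ m ℕ.* (p ℕ.^ m) ℕ.^ q                   <⟨ *-^-<-^ (p ℕ.^ m) {{ℕ.m^n≢0 p m}} lt large ⟩
    (size B ℕ.* d ℕ.^ m) ℕ.^ q                    ≡⟨ ^-distribʳ-* q (size B) (d ℕ.^ m) ⟩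
    size B ℕ.^ q ℕ.* (d ℕ.^ m) ℕ.^ q              ≡⟨ cong₂ ℕ._*_ (sym size≡) (sym (^-swap d)) ⟩
    size (single 𝟎 ⊗ power B q) ℕ.* d ℕ.^ (q ℕ.* m)
      ≤⟨ ℕ.*-monoʳ-≤ (size (single 𝟎 ⊗ power B q)) (ℕ.^-monoʳ-≤ d (ℕ.m≤n+m (q ℕ.* m) r)) ⟩
    size (single 𝟎 ⊗ power B q) ℕ.* d ℕ.^ (r ℕ.+ q ℕ.* m) ∎)
    where
    ^-swap : ∀ x → x ℕ.^ (q ℕ.* m) ≡ (x ℕ.^ m) ℕ.^ q
    ^-swap x = trans (cong (x ℕ.^_) (ℕ.*-comm q m)) (sym (ℕ.^-*-assoc x m q))
    size≡ : size (single {r} 𝟎 ⊗ power B q) ≡ size B ℕ.^ q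
    size≡ = trans (size-⊗ (single 𝟎) (power B q)) (trans (ℕ.*-identityˡ _) (size-power B q))

-- Rational arithmetic

ι : ℕ → ℚ
ι n = + n / 1

-- With explicit numerator and denominator, order and product of these rationals reduce to those of
-- integers.
ι-reduced : ∀ n → ι n ≡ mkℚ (+ n) 0 (Coprime.sym (Coprime.1-coprimeTo n))
ι-reduced n = ℚ.↥p/↧p≡p (mkℚ (+ n) 0 (Coprime.sym (Coprime.1-coprimeTo n)))

ι-mono-≤ : ∀ {m n} → m ℕ.≤ n → ι m ℚ.≤ ι n
ι-mono-≤ {m} {n} m≤n = subst₂ ℚ._≤_ (sym (ι-reduced m)) (sym (ι-reduced n))
  (ℚ.*≤* (ℤ.*-monoʳ-≤-nonNeg (+ 1) (ℤ.+≤+ m≤n)))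

ι-mono-< : ∀ {m n} → m ℕ.< n → ι m ℚ.< ι n
ι-mono-< {m} {n} m<n = subst₂ ℚ._<_ (sym (ι-reduced m)) (sym (ι-reduced n))
  (ℚ.*<* (ℤ.*-monoʳ-<-pos (+ 1) (ℤ.+<+ m<n)))

ι-homo-* : ∀ m n → ι (m ℕ.* n) ≡ ι m ℚ.* ι n
ι-homo-* m n = trans (cong (_/ 1) (ℤ.pos-* m n)) (sym (cong₂ ℚ._*_ (ι-reduced m) (ι-reduced n)))

i≤∣i∣ : ∀ i → i ℤ.≤ + ℤ.∣ i ∣
i≤∣i∣ (+ n)      = ℤ.≤-refl
i≤∣i∣ ℤ.-[1+ n ] = ℤ.-≤+

archimedean : ∀ p → ∃[ n ] p ℚ.< ι n
archimedean p@(mkℚ num d _) = suc ℤ.∣ num ∣ , subst (p ℚ.<_) (sym (ι-reduced (suc ℤ.∣ num ∣)))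
  (ℚ.*<* (begin-strict
    num ℤ.* + 1                  ≡⟨ ℤ.*-identityʳ num ⟩
    num                          ≤⟨ i≤∣i∣ num ⟩
    + ℤ.∣ num ∣                  <⟨ ℤ.+<+ (ℕ.n<1+n _) ⟩
    + suc ℤ.∣ num ∣              ≤⟨ ℤ.+≤+ (ℕ.m≤m*n (suc ℤ.∣ num ∣) (suc d)) ⟩
    + (suc ℤ.∣ num ∣ ℕ.* suc d)  ≡⟨ ℤ.pos-* (suc ℤ.∣ num ∣) (suc d) ⟩
    + suc ℤ.∣ num ∣ ℤ.* + suc d  ∎))
  where open ℤ.≤-Reasoning

infixr 8 _^ℚ_
_^ℚ_ : ℚ → ℕ → ℚ
x ^ℚ zero  = 1ℚ
x ^ℚ suc k = x ℚ.* x ^ℚ k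

ι-homo-^ : ∀ n k → ι (n ℕ.^ k) ≡ ι n ^ℚ k
ι-homo-^ n zero    = refl
ι-homo-^ n (suc k) = trans (ι-homo-* n (n ℕ.^ k)) (cong (ι n ℚ.*_) (ι-homo-^ n k))

^ℚ-distrib-* : ∀ k x y → (x ℚ.* y) ^ℚ k ≡ x ^ℚ k ℚ.* y ^ℚ k
^ℚ-distrib-* zero    x y = refl
^ℚ-distrib-* (suc k) x y = trans (cong (x ℚ.* y ℚ.*_) (^ℚ-distrib-* k x y))
  (solve 4 (λ x y u v → x :* y :* (u :* v) := x :* u :* (y :* v)) refl x y (x ^ℚ k) (y ^ℚ k))
  where open ℚ-Solver

∣^ℚ∣ : ∀ x k → ∣ x ^ℚ k ∣ ≡ ∣ x ∣ ^ℚ k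
∣^ℚ∣ x zero    = refl
∣^ℚ∣ x (suc k) = trans (ℚ.∣p*q∣≡∣p∣*∣q∣ x (x ^ℚ k)) (cong (∣ x ∣ ℚ.*_) (∣^ℚ∣ x k))

seq-^ : ∀ x k n → seq (x ^ k) n ≡ seq x n ^ℚ k
seq-^ x zero    n = refl
seq-^ x (suc k) n = cong (seq x n ℚ.*_) (seq-^ x k n)

*-mono-≤-nonNeg : ∀ {p q r s} → 0ℚ ℚ.≤ q → 0ℚ ℚ.≤ r → p ℚ.≤ q → r ℚ.≤ s → p ℚ.* r ℚ.≤ q ℚ.* s
*-mono-≤-nonNeg {p} {q} {r} {s} 0≤q 0≤r p≤q r≤s = ℚ.≤-trans
  (ℚ.*-monoʳ-≤-nonNeg r {{ℚ.nonNegative 0≤r}} p≤q)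
  (ℚ.*-monoˡ-≤-nonNeg q {{ℚ.nonNegative 0≤q}} r≤s)

*-nonNeg : ∀ {p q} → 0ℚ ℚ.≤ p → 0ℚ ℚ.≤ q → 0ℚ ℚ.≤ p ℚ.* q
*-nonNeg {p} {q} 0≤p 0≤q = subst (ℚ._≤ p ℚ.* q) (ℚ.*-zeroˡ 0ℚ) (*-mono-≤-nonNeg 0≤p ℚ.≤-refl 0≤p 0≤q)

0≤1ℚ : 0ℚ ℚ.≤ 1ℚ
0≤1ℚ = ℚ.<⇒≤ (ℚ.positive⁻¹ 1ℚ)

^ℚ-nonNeg : ∀ {x} k → 0ℚ ℚ.≤ x → 0ℚ ℚ.≤ x ^ℚ k
^ℚ-nonNeg zero    0≤x = 0≤1ℚ
^ℚ-nonNeg (suc k) 0≤x = *-nonNeg 0≤x (^ℚ-nonNeg k 0≤x)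

^ℚ-pos : ∀ {x} k → 0ℚ ℚ.< x → ℚ.Positive (x ^ℚ k)
^ℚ-pos zero    0<x = _
^ℚ-pos {x} (suc k) 0<x = ℚ.pos*pos⇒pos x {{ℚ.positive 0<x}} (x ^ℚ k) {{^ℚ-pos k 0<x}}

^ℚ-mono-≤ : ∀ {x y} k → 0ℚ ℚ.≤ x → x ℚ.≤ y → x ^ℚ k ℚ.≤ y ^ℚ k
^ℚ-mono-≤ zero    0≤x x≤y = ℚ.≤-refl
^ℚ-mono-≤ (suc k) 0≤x x≤y =
  *-mono-≤-nonNeg (ℚ.≤-trans 0≤x x≤y) (^ℚ-nonNeg k 0≤x) x≤y (^ℚ-mono-≤ k 0≤x x≤y)

-- A Lipschitz constant of x ↦ x ^ k on [0, h].
slope : ℚ → ℕ → ℚ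
slope h zero    = 0ℚ
slope h (suc k) = h ℚ.* slope h k ℚ.+ h ^ℚ k

slope-nonNeg : ∀ {h} k → 0ℚ ℚ.≤ h → 0ℚ ℚ.≤ slope h k
slope-nonNeg zero    0≤h = ℚ.≤-refl
slope-nonNeg (suc k) 0≤h = ℚ.+-mono-≤ (*-nonNeg 0≤h (slope-nonNeg k 0≤h)) (^ℚ-nonNeg k 0≤h)

≤⇒0≤- : ∀ {p q} → p ℚ.≤ q → 0ℚ ℚ.≤ q ℚ.- p
≤⇒0≤- {p} {q} p≤q = subst (ℚ._≤ q ℚ.- p) (ℚ.+-inverseʳ p) (ℚ.+-monoˡ-≤ (ℚ.- p) p≤q)

^ℚ-lipschitz : ∀ {h x y} k → 0ℚ ℚ.≤ x → x ℚ.≤ y → y ℚ.≤ h →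
  y ^ℚ k ℚ.- x ^ℚ k ℚ.≤ slope h k ℚ.* (y ℚ.- x)
^ℚ-lipschitz {h} {x} {y} zero 0≤x x≤y y≤h = ℚ.≤-reflexive (sym (ℚ.*-zeroˡ (y ℚ.- x)))
^ℚ-lipschitz {h} {x} {y} (suc k) 0≤x x≤y y≤h = begin
  y ℚ.* y ^ℚ k ℚ.- x ℚ.* x ^ℚ k
    ≡⟨ solve 4 (λ x y u v → y :* v :- x :* u := y :* (v :- u) :+ u :* (y :- x)) refl x y (x ^ℚ k) (y ^ℚ k) ⟩
  y ℚ.* (y ^ℚ k ℚ.- x ^ℚ k) ℚ.+ x ^ℚ k ℚ.* (y ℚ.- x)
    ≤⟨ ℚ.+-mono-≤
         (*-mono-≤-nonNeg 0≤h (≤⇒0≤- (^ℚ-mono-≤ k 0≤x x≤y)) y≤h (^ℚ-lipschitz k 0≤x x≤y y≤h))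
         (*-mono-≤-nonNeg (^ℚ-nonNeg k 0≤h) (≤⇒0≤- x≤y) (^ℚ-mono-≤ k 0≤x (ℚ.≤-trans x≤y y≤h)) ℚ.≤-refl) ⟩
  h ℚ.* (slope h k ℚ.* (y ℚ.- x)) ℚ.+ h ^ℚ k ℚ.* (y ℚ.- x)
    ≡⟨ solve 4 (λ h s p d → h :* (s :* d) :+ p :* d := (h :* s :+ p) :* d) refl h (slope h k) (h ^ℚ k) (y ℚ.- x) ⟩
  slope h (suc k) ℚ.* (y ℚ.- x) ∎
  where
  open ℚ.≤-Reasoning
  open ℚ-Solver
  0≤h : 0ℚ ℚ.≤ h
  0≤h = ℚ.≤-trans 0≤x (ℚ.≤-trans x≤y y≤h)

-- Here x = p/q; multiplying by q^k turns bounds on x^k into inequalities between natural numbers.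
module _ {x : ℚ} (p q : ℕ) (xq≡p : x ℚ.* ι q ≡ ι p) (0<q : 0ℚ ℚ.< ι q) where

  numerator-^ : ∀ k → ι (p ℕ.^ k) ≡ x ^ℚ k ℚ.* ι q ^ℚ k
  numerator-^ k = trans (ι-homo-^ p k) (trans (cong (_^ℚ k) (sym xq≡p)) (^ℚ-distrib-* k x (ι q)))

  scaled-^ : ∀ m k → ι (m ℕ.* q ℕ.^ k) ≡ ι m ℚ.* ι q ^ℚ k
  scaled-^ m k = trans (ι-homo-* m (q ℕ.^ k)) (cong (ι m ℚ.*_) (ι-homo-^ q k))

  denominator-nonNeg : ∀ k → ℚ.NonNegative (ι q ^ℚ k)
  denominator-nonNeg k = ℚ.pos⇒nonNeg (ι q ^ℚ k) {{^ℚ-pos k 0<q}}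

  fraction-^-≤ : ∀ m k → p ℕ.^ k ℕ.≤ m ℕ.* q ℕ.^ k → x ^ℚ k ℚ.≤ ι m
  fraction-^-≤ m k p≤ = ℚ.*-cancelʳ-≤-pos (ι q ^ℚ k) {{^ℚ-pos k 0<q}}
    (subst₂ ℚ._≤_ (numerator-^ k) (scaled-^ m k) (ι-mono-≤ p≤))

  fraction-^-< : ∀ m k → p ℕ.^ k ℕ.< m ℕ.* q ℕ.^ k → x ^ℚ k ℚ.< ι m
  fraction-^-< m k p< = ℚ.*-cancelʳ-<-nonNeg (ι q ^ℚ k) {{denominator-nonNeg k}}
    (subst₂ ℚ._<_ (numerator-^ k) (scaled-^ m k) (ι-mono-< p<))

  fraction-^-> : ∀ m k → m ℕ.* q ℕ.^ k ℕ.< p ℕ.^ k → ι m ℚ.< x ^ℚ k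
  fraction-^-> m k p> = ℚ.*-cancelʳ-<-nonNeg (ι q ^ℚ k) {{denominator-nonNeg k}}
    (subst₂ ℚ._<_ (scaled-^ m k) (numerator-^ k) (ι-mono-< p>))

-- Roots by bisection

∣∣-≤ : ∀ {p q} → p ℚ.≤ q → ℚ.- p ℚ.≤ q → ∣ p ∣ ℚ.≤ q
∣∣-≤ {p} p≤q -p≤q with ℚ.∣p∣≡p∨∣p∣≡-p p
... | inj₁ eq = ℚ.≤-trans (ℚ.≤-reflexive eq) p≤q
... | inj₂ eq = ℚ.≤-trans (ℚ.≤-reflexive eq) -p≤q

distance-≤ : ∀ {l h x y} → l ℚ.≤ x → x ℚ.≤ h → l ℚ.≤ y → y ℚ.≤ h → ∣ x ℚ.- y ∣ ℚ.≤ h ℚ.- l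
distance-≤ {l} {h} {x} {y} l≤x x≤h l≤y y≤h = ∣∣-≤
  (ℚ.+-mono-≤ x≤h (ℚ.neg-antimono-≤ l≤y))
  (subst (ℚ._≤ h ℚ.- l) (solve 2 (λ x y → y :- x := :- (x :- y)) refl x y)
    (ℚ.+-mono-≤ y≤h (ℚ.neg-antimono-≤ l≤x)))
  where open ℚ-Solver

ratio : ∀ {e} → 0ℚ ℚ.< e → ∀ w → ∃[ p ] e ℚ.* p ≡ w
ratio {e} 0<e w = ℚ.1/ e ℚ.* w , trans (sym (ℚ.*-assoc e (ℚ.1/ e) w))
  (trans (cong (ℚ._* w) (ℚ.*-inverseʳ e)) (ℚ.*-identityˡ w))
  where
  instance
    e≢0 : ℚ.NonZero e
    e≢0 = ℚ.pos⇒nonZero e {{ℚ.positive 0<e}}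

0≤ι : ∀ n → 0ℚ ℚ.≤ ι n
0≤ι n = ι-mono-≤ {0} {n} ℕ.z≤n

module Bisection (k : ℕ) (a l h : ℚ) (0<l : 0ℚ ℚ.< l) (l≤h : l ℚ.≤ h)
                 (l^k≤a : l ^ℚ k ℚ.≤ a) (a<h^k : a ℚ.< h ^ℚ k) where

  record Bracket : Set where
    field
      lo hi  : ℚ
      l≤lo   : l ℚ.≤ lo
      lo≤hi  : lo ℚ.≤ hi
      hi≤h   : hi ℚ.≤ h
      lo^k≤a : lo ^ℚ k ℚ.≤ a
      a<hi^k : a ℚ.< hi ^ℚ k

  open Bracket

  width : Bracket → ℚ
  width b = hi b ℚ.- lo b

  record _Halves_ (b′ b : Bracket) : Set where
    field
      lo≤lo′ : lo b ℚ.≤ lo b′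
      hi′≤hi : hi b′ ℚ.≤ hi b
      width′ : width b′ ≡ ½ ℚ.* width b

  open _Halves_

  module _ (b : Bracket) where
    open ℚ-Solver

    mid : ℚ
    mid = lo b ℚ.+ ½ ℚ.* width b

    0≤½width : 0ℚ ℚ.≤ ½ ℚ.* width b
    0≤½width = *-nonNeg (ℚ.nonNegative⁻¹ ½) (≤⇒0≤- (lo≤hi b))

    hi-mid : hi b ℚ.- mid ≡ ½ ℚ.* width b
    hi-mid = solve 2 (λ x y → y :- (x :+ con ½ :* (y :- x)) := con ½ :* (y :- x)) refl (lo b) (hi b)

    mid-lo : mid ℚ.- lo b ≡ ½ ℚ.* width b
    mid-lo = solve 2 (λ x w → x :+ w :- x := w) refl (lo b) (½ ℚ.* width b)

    lo≤mid : lo b ℚ.≤ mid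
    lo≤mid = subst (ℚ._≤ mid) (ℚ.+-identityʳ (lo b)) (ℚ.+-monoʳ-≤ (lo b) 0≤½width)

    mid≤hi : mid ℚ.≤ hi b
    mid≤hi = subst₂ ℚ._≤_ (ℚ.+-identityʳ mid)
      (trans (cong (mid ℚ.+_) (sym hi-mid)) (solve 2 (λ x y → x :+ (y :- x) := y) refl mid (hi b)))
      (ℚ.+-monoʳ-≤ mid 0≤½width)

    halve : ∃[ b′ ] b′ Halves b
    halve with mid ^ℚ k ℚ.≤? a
    ... | yes mid^k≤a =
      record b { lo = mid ; l≤lo = ℚ.≤-trans (l≤lo b) lo≤mid ; lo≤hi = mid≤hi ; lo^k≤a = mid^k≤a } ,
      record { lo≤lo′ = lo≤mid ; hi′≤hi = ℚ.≤-refl ; width′ = hi-mid }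
    ... | no mid^k≰a =
      record b { hi = mid ; hi≤h = ℚ.≤-trans mid≤hi (hi≤h b) ; lo≤hi = lo≤mid ; a<hi^k = ℚ.≰⇒> mid^k≰a } ,
      record { lo≤lo′ = ℚ.≤-refl ; hi′≤hi = mid≤hi ; width′ = mid-lo }

  bracket : ℕ → Bracket
  bracket zero    = record { lo = l ; hi = h ; l≤lo = ℚ.≤-refl ; lo≤hi = l≤h ; hi≤h = ℚ.≤-refl
                           ; lo^k≤a = l^k≤a ; a<hi^k = a<h^k }
  bracket (suc n) = proj₁ (halve (bracket n))

  nested : ∀ {m n} → m ℕ.≤′ n → lo (bracket m) ℚ.≤ lo (bracket n) × hi (bracket n) ℚ.≤ hi (bracket m)
  nested (ℕ.≤′-reflexive refl) = ℚ.≤-refl , ℚ.≤-refl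
  nested {m} (ℕ.≤′-step {n} m≤n) =
    let lo≤ , hi≤ = nested m≤n ; halves = proj₂ (halve (bracket n))
    in ℚ.≤-trans lo≤ (lo≤lo′ halves) , ℚ.≤-trans (hi′≤hi halves) hi≤

  lo-within : ∀ {m n} → m ℕ.≤ n → lo (bracket m) ℚ.≤ lo (bracket n) × lo (bracket n) ℚ.≤ hi (bracket m)
  lo-within {m} {n} m≤n = let lo≤ , hi≤ = nested (ℕ.≤⇒≤′ m≤n) in
    lo≤ , ℚ.≤-trans (lo≤hi (bracket n)) hi≤

  -- Halving outpaces 1/(n + 1) because n + 2 ≤ 2(n + 1). A bound of this form lets the archimedean
  -- property supply the index directly.
  width-bound : ∀ n → width (bracket n) ℚ.* ι (suc n) ℚ.≤ h ℚ.- l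
  width-bound zero    = ℚ.≤-reflexive (ℚ.*-identityʳ (h ℚ.- l))
  width-bound (suc n) = begin
    width (bracket (suc n)) ℚ.* ι (2 ℕ.+ n)
      ≡⟨ cong (ℚ._* ι (2 ℕ.+ n)) (width′ (proj₂ (halve (bracket n)))) ⟩
    ½ ℚ.* w ℚ.* ι (2 ℕ.+ n)
      ≤⟨ ℚ.*-monoˡ-≤-nonNeg (½ ℚ.* w) {{ℚ.nonNegative (0≤½width (bracket n))}} (ι-mono-≤ 2+n≤2*1+n) ⟩
    ½ ℚ.* w ℚ.* ι (2 ℕ.* suc n)
      ≡⟨ cong (½ ℚ.* w ℚ.*_) (ι-homo-* 2 (suc n)) ⟩
    ½ ℚ.* w ℚ.* (ι 2 ℚ.* ι (suc n))
      ≡⟨ solve 2 (λ w i → con ½ :* w :* (con (ι 2) :* i) := w :* i) refl w (ι (suc n)) ⟩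
    w ℚ.* ι (suc n)
      ≤⟨ width-bound n ⟩
    h ℚ.- l ∎
    where
    open ℚ.≤-Reasoning
    open ℚ-Solver
    w : ℚ
    w = width (bracket n)
    2+n≤2*1+n : 2 ℕ.+ n ℕ.≤ 2 ℕ.* suc n
    2+n≤2*1+n = ℕ.s≤s (subst (suc n ℕ.≤_) (ℕ.+-comm (suc n ℕ.+ 0) n)
      (ℕ.≤-trans (ℕ.≤-reflexive (sym (ℕ.+-identityʳ (suc n)))) (ℕ.m≤m+n (suc n ℕ.+ 0) n)))

  width-small : ∀ {e} → 0ℚ ℚ.< e → ∃[ K ] width (bracket K) ℚ.< e
  width-small {e} 0<e with ratio 0<e (h ℚ.- l)
  ... | p , ep≡ with archimedean p
  ... | K , p<K = K , ℚ.*-cancelʳ-<-nonNeg (ι (suc K)) {{ℚ.nonNegative (0≤ι (suc K))}} (begin-strict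
    width (bracket K) ℚ.* ι (suc K)   ≤⟨ width-bound K ⟩
    h ℚ.- l                           ≡⟨ sym ep≡ ⟩
    e ℚ.* p                           <⟨ ℚ.*-monoʳ-<-pos e {{ℚ.positive 0<e}} p<K ⟩
    e ℚ.* ι K                         ≤⟨ ℚ.*-monoˡ-≤-nonNeg e {{ℚ.nonNegative (ℚ.<⇒≤ 0<e)}} (ι-mono-≤ (ℕ.n≤1+n K)) ⟩
    e ℚ.* ι (suc K)                   ∎)
    where open ℚ.≤-Reasoning

  lo-close : ∀ K {m n} → K ℕ.≤ m → K ℕ.≤ n → ∣ lo (bracket m) ℚ.- lo (bracket n) ∣ ℚ.≤ width (bracket K)
  lo-close K {m} {n} K≤m K≤n =
    let l≤m , m≤h = lo-within {K} {m} K≤m ; l≤n , n≤h = lo-within {K} {n} K≤n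
    in distance-≤ l≤m m≤h l≤n n≤h

  root : ℝ
  root = mkℝ (λ n → lo (bracket n)) λ e 0<e →
    let K , w<e = width-small 0<e
    in K , λ m n K≤m K≤n → ℚ.≤-<-trans (lo-close K K≤m K≤n) w<e

  -- Every term obeys the bounds, not only the limit, so inequalities for the real root reduce to
  -- rational ones term by term.
  root-bounds : ∀ n → l ℚ.≤ seq root n × seq root n ℚ.≤ h
  root-bounds n = lo-within {0} {n} ℕ.z≤n

  0≤lo : ∀ b → 0ℚ ℚ.≤ lo b
  0≤lo b = ℚ.≤-trans (ℚ.<⇒≤ 0<l) (l≤lo b)

  -- The bracket places a between the k-th powers of its ends, whose difference the Lipschitz bound
  -- controls.
  lo^k-error : ∀ b → ∣ lo b ^ℚ k ℚ.- a ∣ ℚ.≤ slope h k ℚ.* width b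
  lo^k-error b = ℚ.≤-trans
    (distance-≤ ℚ.≤-refl (^ℚ-mono-≤ k (0≤lo b) (lo≤hi b)) (lo^k≤a b) (ℚ.<⇒≤ (a<hi^k b)))
    (^ℚ-lipschitz k (0≤lo b) (lo≤hi b) (hi≤h b))

  root-^ : root ^ k ≃ fromℚ a
  root-^ e 0<e = K , λ n K≤n → begin-strict
    ∣ seq (root ^ k) n ℚ.- a ∣                  ≡⟨ cong (λ x → ∣ x ℚ.- a ∣) (seq-^ root k n) ⟩
    ∣ lo (bracket n) ^ℚ k ℚ.- a ∣               ≤⟨ lo^k-error (bracket n) ⟩
    slope h k ℚ.* width (bracket n)             ≤⟨ *-mono-≤-nonNeg (ℚ.<⇒≤ 0<s) (≤⇒0≤- (lo≤hi (bracket n)))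
                                                     s≤s′ (width-mono {n} K≤n) ⟩
    s ℚ.* width (bracket K)                     <⟨ ℚ.*-monoʳ-<-pos s {{ℚ.positive 0<s}} w<d ⟩
    s ℚ.* d                                     ≡⟨ sd≡e ⟩
    e                                           ∎
    where
    open ℚ.≤-Reasoning
    s : ℚ
    -- The summand 1 keeps s positive even for k = 0, so that e can be divided by s.
    s = 1ℚ ℚ.+ slope h k
    0≤slope : 0ℚ ℚ.≤ slope h k
    0≤slope = slope-nonNeg k (ℚ.≤-trans (ℚ.<⇒≤ 0<l) l≤h)
    0<s : 0ℚ ℚ.< s
    0<s = ℚ.+-mono-<-≤ (ℚ.positive⁻¹ 1ℚ) 0≤slope
    s≤s′ : slope h k ℚ.≤ s
    s≤s′ = subst (ℚ._≤ s) (ℚ.+-identityˡ (slope h k)) (ℚ.+-monoˡ-≤ (slope h k) 0≤1ℚ)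
    d : ℚ
    d = proj₁ (ratio 0<s e)
    sd≡e : s ℚ.* d ≡ e
    sd≡e = proj₂ (ratio 0<s e)
    0<d : 0ℚ ℚ.< d
    0<d = ℚ.*-cancelˡ-<-nonNeg s {{ℚ.nonNegative (ℚ.<⇒≤ 0<s)}}
      (subst₂ ℚ._<_ (sym (ℚ.*-zeroʳ s)) (sym sd≡e) 0<e)
    K : ℕ
    K = proj₁ (width-small 0<d)
    w<d : width (bracket K) ℚ.< d
    w<d = proj₂ (width-small 0<d)
    width-mono : ∀ {n} → K ℕ.≤ n → width (bracket n) ℚ.≤ width (bracket K)
    width-mono {n} K≤n = let lo≤ , hi≤ = nested {K} {n} (ℕ.≤⇒≤′ K≤n) in
      ℚ.+-mono-≤ hi≤ (ℚ.neg-antimono-≤ lo≤)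

-- Reals with bounded terms

-- The order on the reals asks for a positive gap with strict inequality left over; a rational
-- strictly between p and q provides both.
gap : ∀ {p q} → p ℚ.< q → ∃[ d ] (0ℚ ℚ.< d × p ℚ.+ d ℚ.< q)
gap {p} {q} p<q with ℚ.<-dense p<q
... | r , p<r , r<q = r ℚ.- p ,
  subst (ℚ._< r ℚ.- p) (ℚ.+-inverseʳ p) (ℚ.+-monoˡ-< (ℚ.- p) p<r) ,
  subst (ℚ._< q) (solve 2 (λ p r → r := p :+ (r :- p)) refl p r) r<q
  where open ℚ-Solver

terms≤⇒< : ∀ x {q r} → q ℚ.< r → ∀ {K} → (∀ n → K ℕ.≤ n → seq x n ℚ.≤ q) → x < fromℚ r
terms≤⇒< x q<r {K} x≤q = let d , 0<d , q+d<r = gap q<r in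
  d , 0<d , K , λ n K≤n → ℚ.≤-<-trans (ℚ.+-monoˡ-≤ d (x≤q n K≤n)) q+d<r

terms≥⇒> : ∀ x {q r} → q ℚ.< r → (∀ n → r ℚ.≤ seq x n) → fromℚ q < x
terms≥⇒> x q<r r≤x = let d , 0<d , q+d<r = gap q<r in
  d , 0<d , 0 , λ n _ → ℚ.<-≤-trans q+d<r (r≤x n)

terms≥⇒≥ : ∀ x {q} → (∀ n → q ℚ.≤ seq x n) → fromℚ q ≤ x
terms≥⇒≥ x {q} q≤x (d , 0<d , K , x+d<q) = ℚ.<-irrefl refl (begin-strict
  q                 ≤⟨ q≤x K ⟩
  seq x K           ≡⟨ sym (ℚ.+-identityʳ (seq x K)) ⟩
  seq x K ℚ.+ 0ℚ    <⟨ ℚ.+-monoʳ-< (seq x K) 0<d ⟩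
  seq x K ℚ.+ d     <⟨ x+d<q K ℕ.≤-refl ⟩
  q                 ∎)
  where open ℚ.≤-Reasoning

p≤∣p∣ : ∀ p → p ℚ.≤ ∣ p ∣
p≤∣p∣ p with ℚ.≤-total 0ℚ p
... | inj₁ 0≤p = ℚ.≤-reflexive (sym (ℚ.0≤p⇒∣p∣≡p 0≤p))
... | inj₂ p≤0 = ℚ.≤-trans p≤0 (ℚ.0≤∣p∣ p)

-- The sign of t K + e/2 at a single late index K is decidable, and if it is negative
-- then x < y.
≤⇒difference> : ∀ x y → y ≤ x → ∀ {e} → 0ℚ ℚ.< e →
  ∃[ K ] (∀ n → K ℕ.≤ n → ℚ.- e ℚ.< seq x n ℚ.- seq y n)
≤⇒difference> x y y≤x {e} 0<e = from-modulus (cauchy (x - y) (½ ℚ.* e) 0<½e)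
  where
  open ℚ.≤-Reasoning
  open ℚ-Solver
  t : ℕ → ℚ
  t n = seq x n ℚ.- seq y n
  0<½e : 0ℚ ℚ.< ½ ℚ.* e
  0<½e = subst (ℚ._< ½ ℚ.* e) (ℚ.*-zeroʳ ½) (ℚ.*-monoʳ-<-pos ½ 0<e)
  from-modulus : ∃[ K ] (∀ m n → K ℕ.≤ m → K ℕ.≤ n → ∣ t m ℚ.- t n ∣ ℚ.< ½ ℚ.* e) →
    ∃[ K ] (∀ n → K ℕ.≤ n → ℚ.- e ℚ.< t n)
  from-modulus (K , modulus) = K , late (t K ℚ.<? ℚ.- (½ ℚ.* e))
    where
    close : ∀ m n → K ℕ.≤ m → K ℕ.≤ n → t m ℚ.- t n ℚ.< ½ ℚ.* e
    close m n K≤m K≤n = ℚ.≤-<-trans (p≤∣p∣ (t m ℚ.- t n)) (modulus m n K≤m K≤n)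
    d : ℚ
    d = ℚ.- (t K ℚ.+ ½ ℚ.* e)
    late : Dec (t K ℚ.< ℚ.- (½ ℚ.* e)) → ∀ n → K ℕ.≤ n → ℚ.- e ℚ.< t n
    late (yes tK<) = ⊥-elim (y≤x (d , 0<d , K , x+d<y))
      where
      0<d : 0ℚ ℚ.< d
      0<d = subst₂ ℚ._<_ (ℚ.+-inverseʳ (t K)) (solve 2 (λ t h → :- h :- t := :- (t :+ h)) refl (t K) (½ ℚ.* e))
        (ℚ.+-monoˡ-< (ℚ.- t K) tK<)
      x+d<y : ∀ n → K ℕ.≤ n → seq x n ℚ.+ d ℚ.< seq y n
      x+d<y n K≤n = subst₂ ℚ._<_
        (solve 4 (λ x y t h → x :- y :- t :+ (y :- h) := x :+ :- (t :+ h)) refl (seq x n) (seq y n) (t K) (½ ℚ.* e))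
        (solve 2 (λ y h → h :+ (y :- h) := y) refl (seq y n) (½ ℚ.* e))
        (ℚ.+-monoˡ-< (seq y n ℚ.- ½ ℚ.* e) (close n K K≤n ℕ.≤-refl))
    late (no tK≮) n K≤n = begin-strict
      ℚ.- e                             ≡⟨ solve 1 (λ e → :- e := :- (con ½ :* e) :- con ½ :* e) refl e ⟩
      ℚ.- (½ ℚ.* e) ℚ.- ½ ℚ.* e         ≤⟨ ℚ.+-monoˡ-≤ (ℚ.- (½ ℚ.* e)) (ℚ.≮⇒≥ tK≮) ⟩
      t K ℚ.- ½ ℚ.* e                   <⟨ ℚ.+-monoʳ-< (t K) (ℚ.neg-antimono-< (close K n ℕ.≤-refl K≤n)) ⟩
      t K ℚ.- (t K ℚ.- t n)             ≡⟨ solve 2 (λ a b → a :- (a :- b) := b) refl (t K) (t n) ⟩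
      t n                               ∎

-- The terms of c - ε may be slightly negative even though ε ≤ c, so their absolute values are
-- bounded: late terms lie above -l, hence above -h, and at most at h because ε is positive.
power-difference-< : ∀ {l h} c → 0ℚ ℚ.< l → (∀ j → l ℚ.≤ seq c j × seq c j ℚ.≤ h) →
  ∀ ε → fromℕ 0 < ε → ε ≤ c → ∀ {n s} → h ^ℚ n ℚ.< ι s → (c - ε) ^ n < fromℕ s
power-difference-< {l} {h} c 0<l bounds ε (d , 0<d , K₁ , d<ε) ε≤c {n} {s} h^n<s =
  terms≤⇒< ((c - ε) ^ n) h^n<s {K₁ ℕ.⊔ K₂} λ j K≤j → begin
    seq ((c - ε) ^ n) j                   ≡⟨ seq-^ (c - ε) n j ⟩
    (seq c j ℚ.- seq ε j) ^ℚ n            ≤⟨ p≤∣p∣ _ ⟩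
    ∣ (seq c j ℚ.- seq ε j) ^ℚ n ∣        ≡⟨ ∣^ℚ∣ (seq c j ℚ.- seq ε j) n ⟩
    ∣ seq c j ℚ.- seq ε j ∣ ^ℚ n          ≤⟨ ^ℚ-mono-≤ n (ℚ.0≤∣p∣ _) (small j K≤j) ⟩
    h ^ℚ n                                ∎
  where
  open ℚ.≤-Reasoning
  open ℚ-Solver
  late : ∃[ K ] (∀ j → K ℕ.≤ j → ℚ.- l ℚ.< seq c j ℚ.- seq ε j)
  late = ≤⇒difference> c ε ε≤c 0<l
  K₂ : ℕ
  K₂ = proj₁ late
  small : ∀ j → K₁ ℕ.⊔ K₂ ℕ.≤ j → ∣ seq c j ℚ.- seq ε j ∣ ℚ.≤ h
  small j K≤j = ∣∣-≤
    (begin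
      seq c j ℚ.- seq ε j     ≤⟨ ℚ.+-monoʳ-≤ (seq c j) (ℚ.neg-antimono-≤ 0≤ε) ⟩
      seq c j ℚ.- 0ℚ          ≡⟨ ℚ.+-identityʳ (seq c j) ⟩
      seq c j                 ≤⟨ proj₂ (bounds j) ⟩
      h                       ∎)
    (begin
      ℚ.- (seq c j ℚ.- seq ε j)   ≤⟨ ℚ.neg-antimono-≤ (ℚ.<⇒≤ (proj₂ late j (ℕ.m⊔n≤o⇒n≤o K₁ K₂ K≤j))) ⟩
      ℚ.- (ℚ.- l)                 ≡⟨ solve 1 (λ l → :- (:- l) := l) refl l ⟩
      l                           ≤⟨ proj₁ (bounds j) ⟩
      seq c j                     ≤⟨ proj₂ (bounds j) ⟩
      h                           ∎)
    where
    0≤ε : 0ℚ ℚ.≤ seq ε j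
    0≤ε = begin
      0ℚ            ≤⟨ ℚ.<⇒≤ 0<d ⟩
      d             ≡⟨ sym (ℚ.+-identityˡ d) ⟩
      0ℚ ℚ.+ d      ≤⟨ ℚ.<⇒≤ (d<ε j (ℕ.m⊔n≤o⇒m≤o K₁ K₂ K≤j)) ⟩
      seq ε j       ∎

-- The constant c and the theorem

-- With k and m as variables the bisection stays free of large numerals.
root-exists : ∀ k m {l h} p q p′ q′ → l ℚ.* ι q ≡ ι p → 0ℚ ℚ.< ι q → h ℚ.* ι q′ ≡ ι p′ → 0ℚ ℚ.< ι q′ →
  0ℚ ℚ.< l → l ℚ.≤ h → p ℕ.^ k ℕ.≤ m ℕ.* q ℕ.^ k → m ℕ.* q′ ℕ.^ k ℕ.< p′ ℕ.^ k →
  Σ[ c ∈ ℝ ] (c ^ k ≃ fromℕ m × (∀ n → l ℚ.≤ seq c n × seq c n ℚ.≤ h))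
root-exists k m {l} {h} p q p′ q′ lq≡p 0<q hq′≡p′ 0<q′ 0<l l≤h lower upper = root , root-^ , root-bounds
  where open Bisection k (ι m) l h 0<l l≤h (fraction-^-≤ p q lq≡p 0<q m k lower) (fraction-^-> p′ q′ hq′≡p′ 0<q′ m k upper)

c-lower c-upper : ℚ
c-lower = + 2218021 / 1000000
c-upper = + 22180213 / 10000000

0<c-lower : 0ℚ ℚ.< c-lower
0<c-lower = ℚ.positive⁻¹ c-lower

opaque
  c-exists : Σ[ c ∈ ℝ ] (c ^ 56232 ≃ fromℕ N × (∀ n → c-lower ℚ.≤ seq c n × seq c n ℚ.≤ c-upper))
  c-exists = root-exists 56232 N {c-lower} {c-upper} 2218021 1000000 22180213 10000000
    refl (ℚ.positive⁻¹ (ι 1000000)) refl (ℚ.positive⁻¹ (ι 10000000))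
    0<c-lower (from-yes (c-lower ℚ.≤? c-upper)) lower upper

product-of-powers : ∀ {m n} (A : CapSet m) (B : CapSet n) {a b} → size A ≡ a → size B ≡ b →
  ∀ p q s → T (s ℕ.≤ᵇ a ℕ.^ p ℕ.* b ℕ.^ q) → Σ[ C ∈ CapSet (p ℕ.* m ℕ.+ q ℕ.* n) ] size C ≡ s
product-of-powers A B refl refl p q s s≤ = shrink s (power A p ⊗ power B q)
  (subst (s ℕ.≤_) (sym (trans (size-⊗ (power A p) (power B q)) (cong₂ ℕ._*_ (size-power A p) (size-power B q))))
    (ℕ.≤ᵇ⇒≤ s _ s≤))

opaque
  cap56232 : Σ[ A ∈ CapSet 56232 ] size A ≡ N
  -- The dimensions match because 130 · 432 + 12 · 6 = 56232; the label `1F` selects a cap with 112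
  -- points.
  cap56232 = product-of-powers (proj₁ cap432) (System.caps edelSystem 1F)
    (proj₂ cap432) (System.size-caps edelSystem 1F) 130 12 N tt

opaque
  eventually-large : ∃[ M ] (∀ n → M ℕ.≤ n → Σ[ A ∈ CapSet n ] 22180213 ℕ.^ n ℕ.< size A ℕ.* 10000000 ℕ.^ n)
  eventually-large = powers-exceed (proj₁ cap432) 22180213 10000000
    (subst (λ s → 22180213 ℕ.^ 432 ℕ.< s ℕ.* 10000000 ℕ.^ 432) (sym (proj₂ cap432)) (ℕ.<ᵇ⇒< _ _ tt))

theorem1p2 :
  (Σ[ A ∈ CapSet 56232 ] size A ≡ N)
  × (Σ[ c ∈ ℝ ] (c IsPositiveRoot 56232 Of fromℕ N
      × fromℚ (+ 2218021 / 1000000) ≤ c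
      × c < fromℚ (+ 2218022 / 1000000)
      × ((ε : ℝ) → fromℕ 0 < ε → ε ≤ c →
          ∃[ M ] ((n : ℕ) → M ℕ.≤ n →
            Σ[ A ∈ CapSet n ] (c - ε) ^ n < fromℕ (size A)))))
theorem1p2 =
  let c , c^≃N , bounds = c-exists
      M , large         = eventually-large
  in cap56232
   , c
   , (terms≥⇒> c 0<c-lower (proj₁ ∘ bounds) , c^≃N)
   , terms≥⇒≥ c (proj₁ ∘ bounds)
   , terms≤⇒< c (from-yes (c-upper ℚ.<? + 2218022 / 1000000)) {0} (λ n _ → proj₂ (bounds n))
   -- One M works for every ε, since the caps already beat the powers of `c-upper`, which bounds
   -- every term of c.
   , λ ε 0<ε ε≤c → M , λ n M≤n →
       let A , A-large = large n M≤n
       in A , power-difference-< c 0<c-lower bounds ε 0<ε ε≤c {n} {size A}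
                (fraction-^-< 22180213 10000000 refl (ℚ.positive⁻¹ (ι 10000000)) (size A) n A-large)
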